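{- Let $a,k \in \mathbb{N}$ and let $M$ be a connected strong $k$-chromatic-choosable graph. Then $$\frac{(P_\ell(M,k+a-1))^a}{2^{k-1}} \leq f_a(M).$$
   Context: All graphs are finite, simple and nonempty; $\mathbb{N}=\{1,2,\dots\}$. A list assignment $L$ for a graph assigns to each vertex $v$ a set $L(v)$ of colors; a proper $L$-coloring is a proper coloring $c$ with $c(v)\in L(v)$ for all $v$; $G$ is $L$-colorable if one exists. $L$ is a $k$-assignment if $|L(v)|=k$ for all $v$, and is constant if all lists are equal. $\chi_\ell(G)$ is the least $k$ such that $G$ is $L$-colorable for every $k$-assignment $L$. The list color function $P_\ell(G,k)$ is the minimum, over all $k$-assignments $L$ for $G$, of the number of proper $L$-colorings of $G$. A graph $G$ is strong $k$-chromatic-choosable if $\chi(G)=k$ and every $(k-1)$-assignment $L$ for which $G$ is not $L$-colorable is constant. The Cartesian product $G \square H$ has vertex set $V(G)\times V(H)$, with $(u,v)$ adjacent to $(u',v')$ iff either $u=u'$ and $vv'\in E(H)$, or $v=v'$ and $uu'\in E(G)$. $K_{a,b}$ is the complete bipartite graph with parts of sizes $a$ and $b$. $f_a(G)$ denotes the smallest $b\in\mathbb{N}$ such that $\chi_\ell(G \square K_{a,b}) = \chi_\ell(G) + a$. -}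

module Defs where

open import Data.Nat using (ℕ; zero; suc; _+_; _*_; _∸_; _^_; _≤_; _<_)
open import Data.Nat.Base using (_≡ᵇ_; _<ᵇ_)
open import Data.Bool using (Bool; true; false; _∧_; _∨_; not; _xor_; if_then_else_)
open import Data.Fin using (Fin; zero; suc; toℕ; remQuot)
open import Data.Fin.Properties using () renaming (_≟_ to _≟F_)
open import Data.List using (List; []; _∷_; [_]; map; concatMap; length; allFin)
open import Data.Nat.ListAction using (sum)
open import Data.Bool.ListAction using (all)
open import Data.List.Membership.Propositional using (_∈_)
open import Data.List.Relation.Unary.Unique.Propositional using (Unique)
open import Data.Product using (Σ; _×_; _,_; proj₁; proj₂; ∃)
open import Relation.Nullary using (¬_)
open import Relation.Nullary.Decidable using (⌊_⌋)
open import Relation.Binary.PropositionalEquality using (_≡_; _≢_)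
open import Function using (_∘_; _⇔_)

record RawGraph : Set where
  field
    n   : ℕ
    adj : Fin n → Fin n → Bool
open RawGraph public

record Graph : Set where
  field
    raw      : RawGraph
    nonempty : 1 ≤ n raw
    symm     : ∀ u v → adj raw u v ≡ adj raw v u
    irrefl   : ∀ v → adj raw v v ≡ false
open Graph public

Proper : (G : RawGraph) → (Fin (n G) → ℕ) → Set
Proper G c = ∀ u v → adj G u v ≡ true → c u ≢ c v

properᵇ : (G : RawGraph) → (Fin (n G) → ℕ) → Bool
properᵇ G c =
  all (λ u → all (λ v → not (adj G u v) ∨ not (c u ≡ᵇ c v)) (allFin (n G))) (allFin (n G))

Colorable : RawGraph → ℕ → Set
Colorable G k = Σ (Fin (n G) → Fin k) λ c → Proper G (toℕ ∘ c)

ChromaticNumber : RawGraph → ℕ → Set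
ChromaticNumber G k = Colorable G k × (∀ j → j < k → ¬ Colorable G j)

-- List assignments (lists without repetition represent sets of colors)

ListAssignment : RawGraph → Set
ListAssignment G = Fin (n G) → List ℕ

IsKAssignment : (G : RawGraph) → ℕ → ListAssignment G → Set
IsKAssignment G k L = ∀ v → Unique (L v) × length (L v) ≡ k

IsLColoring : (G : RawGraph) → ListAssignment G → (Fin (n G) → ℕ) → Set
IsLColoring G L c = Proper G c × (∀ v → c v ∈ L v)

LColorable : (G : RawGraph) → ListAssignment G → Set
LColorable G L = Σ (Fin (n G) → ℕ) (IsLColoring G L)

IsConstant : (G : RawGraph) → ListAssignment G → Set
IsConstant G L = ∀ u v x → (x ∈ L u) ⇔ (x ∈ L v)

Choosable : RawGraph → ℕ → Set
Choosable G k = ∀ L → IsKAssignment G k L → LColorable G L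

ChoiceNumber : RawGraph → ℕ → Set
ChoiceNumber G k = Choosable G k × (∀ j → j < k → ¬ Choosable G j)

consF : ∀ {m} → ℕ → (Fin m → ℕ) → Fin (suc m) → ℕ
consF x f zero    = x
consF x f (suc i) = f i

choiceFunctions : (m : ℕ) → (Fin m → List ℕ) → List (Fin m → ℕ)
choiceFunctions zero    L = [ (λ ()) ]
choiceFunctions (suc m) L =
  concatMap (λ x → map (consF x) (choiceFunctions m (L ∘ suc))) (L zero)

numLColorings : (G : RawGraph) → ListAssignment G → ℕ
numLColorings G L =
  sum (map (λ c → if properᵇ G c then 1 else 0) (choiceFunctions (n G) L))

ListColorFunction : RawGraph → ℕ → ℕ → Set
ListColorFunction G k p =
  (∃ λ L → IsKAssignment G k L × numLColorings G L ≡ p)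
  × (∀ L → IsKAssignment G k L → p ≤ numLColorings G L)

data Reach (G : RawGraph) : Fin (n G) → Fin (n G) → Set where
  here : ∀ {u} → Reach G u u
  step : ∀ {u v w} → adj G u v ≡ true → Reach G v w → Reach G u w

Connected : RawGraph → Set
Connected G = ∀ u v → Reach G u v

StrongChromaticChoosable : RawGraph → ℕ → Set
StrongChromaticChoosable G k =
  ChromaticNumber G k
  × (∀ L → IsKAssignment G (k ∸ 1) L → ¬ LColorable G L → IsConstant G L)

-- K_{a,b}: vertices Fin (a + b), part A = {i | i < a}, part B the rest

K : ℕ → ℕ → RawGraph
K a b = record { n = a + b ; adj = λ i j → (toℕ i <ᵇ a) xor (toℕ j <ᵇ a) }

_≡F_ : ∀ {m} → Fin m → Fin m → Bool
i ≡F j = ⌊ i ≟F j ⌋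

_□_ : RawGraph → RawGraph → RawGraph
G □ H = record
  { n   = n G * n H
  ; adj = λ x y →
      let (u , v)   = remQuot {n G} (n H) x
          (u' , v') = remQuot {n G} (n H) y
      in (u ≡F u' ∧ adj H v v') ∨ (v ≡F v' ∧ adj G u u')
  }

FaProperty : ℕ → RawGraph → ℕ → Set
FaProperty a G b = ∃ λ c → ChoiceNumber G c × ChoiceNumber (G □ K a b) (c + a)

-- f_a(G) = b  (least b ∈ ℕ = {1,2,…} with the property)
IsFa : ℕ → RawGraph → ℕ → Set
IsFa a G b = 1 ≤ b × FaProperty a G b × (∀ b' → 1 ≤ b' → b' < b → ¬ FaProperty a G b')

{-# OPTIONS --safe #-}
-- If 2^(k-1) b < p^a, then M □ K_{a,b} is (k+a-1)-choosable, which is impossible because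
-- χ_ℓ(M) ≥ χ(M) = k.  Let A_i be the lists on the a copies of M in one part and B_j those on
-- the b copies in the other.
--   If some x lies in A_i(v) ∩ A_l(v) with i ≠ l, use x at v on both copies.  Every copy in the
-- other part keeps at least k-1 colors at each vertex and at least k at v, and strong
-- chromatic-choosability makes such lists colorable.
--   Otherwise the lists A_i(v), for fixed v, are disjoint.  There are at least p^a colorings of
-- the first part.  Such a coloring c fails to extend to copy j only if all its residual lists
-- there equal one set S of size k-1.  Then S, and by disjointness all of c, is determined by
-- the colors c_i(v₀) ∈ A_i(v₀) ∩ B_j(v₀) at a single vertex v₀.  With d_i = |A_i(v₀) ∩ B_j(v₀)|
-- we have Σ d_i ≤ k+a-1 and 2 d_i ≤ 2^(d_i), so at most ∏ d_i ≤ 2^(k-1) colorings fail for j,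
-- and some coloring extends to all b copies.
module Submission where

open import Defs
open import Data.Nat using (ℕ; _+_; _*_; _∸_; _^_; _≤_)
open import Data.Nat using (zero; suc; _<_; _≤?_; z≤n; s≤s; _<ᵇ_; _≡ᵇ_)
open import Data.Nat.Properties
open import Data.Bool as Bool using (Bool; true; false; T; not; _∨_; _∧_; if_then_else_)
open import Data.Bool.Properties using (T-≡; T-∧; T-∨; ¬-not)
open import Data.Empty using (⊥; ⊥-elim)
open import Data.Fin using (Fin; zero; suc; toℕ; splitAt; remQuot; combine; _↑ˡ_; _↑ʳ_; fromℕ<; punchIn; punchOut)
import Data.Fin.Properties as Fin
open import Data.List using (List; []; _∷_; [_]; _++_; map; concat; concatMap; length; filter; tabulate; take; drop; upTo; cartesianProductWith)
open import Data.List.Properties using (length-++; length-map; length-++-sucʳ; length-tabulate; tabulate-cong; length-take; map-++; map-∘; length-upTo)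
open import Data.List.Membership.Propositional using (_∈_; _∉_; find; lose)
open import Data.List.Membership.Propositional.Properties
open import Data.List.Membership.DecPropositional _≟_ using (_∈?_)
open import Data.List.Relation.Unary.All as All using (All; []; _∷_)
import Data.List.Relation.Unary.All.Properties as All
open import Data.List.Relation.Unary.AllPairs using ([]; _∷_)
import Data.List.Relation.Unary.AllPairs.Properties as AllPairs
open import Data.List.Relation.Unary.Any as Any using (here; there)
open import Data.List.Relation.Unary.Unique.Propositional using (Unique)
import Data.List.Relation.Unary.Unique.Propositional.Properties as Unique
open import Data.List.Relation.Binary.Subset.Propositional using (_⊆_)
import Data.List.Relation.Binary.Sublist.Propositional as Sublist
open import Data.List.Relation.Binary.Sublist.Propositional.Properties using (take-⊆; drop-⊆)
open import Data.Nat.ListAction using (sum)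
open import Data.Product using (∃; _×_; _,_; proj₁; proj₂)
open import Data.Sum using (inj₁; inj₂; [_,_]′)
open import Data.Vec as Vec using (Vec; []; _∷_; lookup)
open import Data.Vec.Properties using (∷-injective; lookup∘tabulate; tabulate∘lookup) renaming (tabulate-cong to Vec-tabulate-cong)
open import Function using (_∘_; id; Equivalence)
open import Relation.Binary.PropositionalEquality using (_≡_; _≢_; refl; sym; trans; cong; cong₂; subst; subst₂)
open import Relation.Nullary using (¬_; Dec; yes; no; does; contradiction)
open import Relation.Nullary.Decidable using (¬?; _×-dec_; _→-dec_; decidable-stable; toWitness)
open import Relation.Unary using (Pred; Decidable)
open import Level using (0ℓ)

-- Counting in duplicate-free lists.

private variable
  A B : Set

length-unique-⊆ : {xs ys : List A} → Unique xs → xs ⊆ ys → length xs ≤ length ys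
length-unique-⊆ [] _ = z≤n
length-unique-⊆ {xs = x ∷ xs} (x∉xs ∷ xs!) xs⊆ys
  with as , bs , refl ← ∈-∃++ (xs⊆ys (here refl)) =
  subst (suc (length xs) ≤_) (sym (length-++-sucʳ as x bs))
    (s≤s (length-unique-⊆ xs! xs⊆as++bs))
  where
  xs⊆as++bs : xs ⊆ as ++ bs
  xs⊆as++bs y∈xs with ∈-++⁻ as (xs⊆ys (there y∈xs))
  ... | inj₁ y∈as         = ∈-++⁺ˡ y∈as
  ... | inj₂ (here refl)  = contradiction refl (All.lookup x∉xs y∈xs)
  ... | inj₂ (there y∈bs) = ∈-++⁺ʳ as y∈bs

-- An entry of `ys` missing from `xs` could be put in front of `xs`, giving a duplicate-free list
-- inside `ys` that is too long.
unique-⊆-exhausts : {xs ys : List ℕ} → Unique xs → xs ⊆ ys → length ys ≤ length xs → ys ⊆ xs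
unique-⊆-exhausts {xs} {ys} xs! xs⊆ys ∣ys∣≤∣xs∣ {y} y∈ys with y ∈? xs
... | yes y∈xs = y∈xs
... | no  y∉xs = contradiction (≤-trans (length-unique-⊆ y∷xs! y∷xs⊆ys) ∣ys∣≤∣xs∣) 1+n≰n
  where
  y∷xs! : Unique (y ∷ xs)
  y∷xs! = All.tabulate (λ {z} z∈xs y≡z → y∉xs (subst (_∈ xs) (sym y≡z) z∈xs)) ∷ xs!
  y∷xs⊆ys : y ∷ xs ⊆ ys
  y∷xs⊆ys (here refl)  = y∈ys
  y∷xs⊆ys (there z∈xs) = xs⊆ys z∈xs

-- Injectivity is asked only on `P` because the map of interest, `trace`, is shown injective only on
-- colorings that fail to extend.
unique-map : {P : Pred A 0ℓ} (f : A → B) → (∀ {x y} → P x → P y → f x ≡ f y → x ≡ y) →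
  ∀ {xs} → All P xs → Unique xs → Unique (map f xs)
unique-map f inj [] [] = []
unique-map f inj (px ∷ pxs) (x∉xs ∷ xs!) =
  All.map⁺ (All.zipWith (λ (py , x≢y) fx≡fy → x≢y (inj px py fx≡fy)) (pxs , x∉xs))
  ∷ unique-map f inj pxs xs!

length-filter-¬ : {P : Pred A 0ℓ} (P? : Decidable P) (xs : List A) →
  length (filter P? xs) + length (filter (¬? ∘ P?) xs) ≡ length xs
length-filter-¬ P? [] = refl
length-filter-¬ P? (x ∷ xs) with does (P? x)
... | true  = cong suc (length-filter-¬ P? xs)
... | false = trans (+-suc _ _) (cong suc (length-filter-¬ P? xs))

count≤length-filter : {P : Pred B 0ℓ} (β : A → Bool) (f : A → B) (P? : Decidable P) →
  (∀ x → T (β x) → P (f x)) → ∀ xs →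
  sum (map (λ x → if β x then 1 else 0) xs) ≤ length (filter P? (map f xs))
count≤length-filter β f P? sound [] = z≤n
count≤length-filter β f P? sound (x ∷ xs) with β x | sound x | P? (f x)
... | false | _ | yes _ = m≤n⇒m≤1+n (count≤length-filter β f P? sound xs)
... | false | _ | no  _ = count≤length-filter β f P? sound xs
... | true  | _ | yes _ = s≤s (count≤length-filter β f P? sound xs)
... | true  | s | no ¬p = contradiction (s _) ¬p

∈-take-head : ∀ {m} {x : A} {xs} → m ≢ 0 → x ∈ take m (x ∷ xs)
∈-take-head {m = zero}  0≢0 = contradiction refl 0≢0
∈-take-head {m = suc _} _   = here refl

length-cartesianProductWith : {C : Set} (f : A → B → C) (xs : List A) (ys : List B) →
  length (cartesianProductWith f xs ys) ≡ length xs * length ys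
length-cartesianProductWith f []       ys = refl
length-cartesianProductWith f (x ∷ xs) ys = trans (length-++ (map (f x) ys))
  (cong₂ _+_ (length-map (f x) ys) (length-cartesianProductWith f xs ys))

-- A union bound: discard the entries satisfying each `Q j` in turn, losing at most `N` every time.
-- `P` is carried along because the bound on `Q j` is available only for lists of proper colorings.
avoid : {P : Pred A 0ℓ} (b : ℕ) {N : ℕ} (Q : Fin b → Pred A 0ℓ) → (∀ j → Decidable (Q j)) →
  (∀ j xs → Unique xs → All P xs → All (Q j) xs → length xs ≤ N) →
  ∀ xs → Unique xs → All P xs → b * N < length xs → ∃ λ x → x ∈ xs × (∀ j → ¬ Q j x)
avoid zero    Q Q? bound (x ∷ xs) _ _ _ = x , here refl , λ ()
avoid {P = P} (suc b) {N} Q Q? bound xs xs! pxs lt =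
  let x , x∈rest , ¬Qx = avoid b (Q ∘ suc) (Q? ∘ suc) (bound ∘ suc) rest
        (Unique.filter⁺ (¬? ∘ Q? zero) xs!) (All.filter⁺ (¬? ∘ Q? zero) pxs) b*N<∣rest∣
      x∈xs , ¬Q₀x = ∈-filter⁻ (¬? ∘ Q? zero) {xs = xs} x∈rest
  in x , x∈xs , λ { zero → ¬Q₀x ; (suc j) → ¬Qx j }
  where
  rest = filter (¬? ∘ Q? zero) xs
  ∣Q₀∣≤N : length (filter (Q? zero) xs) ≤ N
  ∣Q₀∣≤N = bound zero _ (Unique.filter⁺ (Q? zero) xs!) (All.filter⁺ (Q? zero) pxs) (All.all-filter (Q? zero) xs)
  b*N<∣rest∣ : b * N < length rest
  b*N<∣rest∣ = +-cancelˡ-< N _ _ (<-≤-trans lt (≤-trans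
    (≤-reflexive (sym (length-filter-¬ (Q? zero) xs))) (+-monoˡ-≤ (length rest) ∣Q₀∣≤N)))

-- Finite families and their choice vectors.

lookup-ext : ∀ {m} {v w : Vec A m} → (∀ i → lookup v i ≡ lookup w i) → v ≡ w
lookup-ext {v = v} {w} eq = trans (sym (tabulate∘lookup v)) (trans (Vec-tabulate-cong eq) (tabulate∘lookup w))

2≤-distinct : ∀ {m} (i j : Fin m) → i ≢ j → 2 ≤ m
2≤-distinct {suc zero}    zero zero 0≢0 = contradiction refl 0≢0
2≤-distinct {suc (suc _)} _    _    _   = s≤s (s≤s z≤n)

-- Skipping the index `i` loses no value, since `j` still contributes `f i`.
repeated-value : ∀ {m} (f : Fin m → A) {i j} → i ≢ j → f i ≡ f j →
  ∃ λ ys → tabulate f ⊆ ys × suc (length ys) ≡ m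
repeated-value {m = suc m} f {i} {j} i≢j fi≡fj = tabulate g , f⊆g , cong suc (length-tabulate g)
  where
  g = f ∘ punchIn i
  hit : ∀ l → i ≢ l → f l ∈ tabulate g
  hit l i≢l = subst (λ l → f l ∈ tabulate g) (Fin.punchIn-punchOut i≢l) (∈-tabulate⁺ {f = g} (punchOut i≢l))
  f⊆g : tabulate f ⊆ tabulate g
  f⊆g x∈f with l , refl ← ∈-tabulate⁻ {f = f} x∈f | i Fin.≟ l
  ... | no  i≢l  = hit l i≢l
  ... | yes refl = subst (_∈ tabulate g) (sym fi≡fj) (hit j i≢j)

-- Vectors replace the functions of `choiceFunctions`: pointwise equal vectors are equal, so
-- `Unique` and counting make sense without function extensionality.
choices : ∀ {m} → (Fin m → List A) → List (Vec A m)
choices {m = zero}  L = [ [] ]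
choices {m = suc m} L = cartesianProductWith _∷_ (L zero) (choices (L ∘ suc))

∈-choices⁺ : ∀ {m} (L : Fin m → List A) (v : Vec A m) → (∀ i → lookup v i ∈ L i) → v ∈ choices L
∈-choices⁺ L []      _   = here refl
∈-choices⁺ L (x ∷ v) v∈L = ∈-cartesianProductWith⁺ _∷_ (v∈L zero) (∈-choices⁺ (L ∘ suc) v (v∈L ∘ suc))

∈-choices⁻ : ∀ {m} (L : Fin m → List A) {v : Vec A m} → v ∈ choices L → ∀ i → lookup v i ∈ L i
∈-choices⁻ {m = suc m} L v∈ i
  with _ , _ , x∈ , w∈ , refl ← ∈-cartesianProductWith⁻ _∷_ (L zero) (choices (L ∘ suc)) v∈ | i
... | zero  = x∈
... | suc j = ∈-choices⁻ (L ∘ suc) w∈ j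

choices-unique : ∀ {m} (L : Fin m → List A) → (∀ i → Unique (L i)) → Unique (choices L)
choices-unique {m = zero}  L L! = [] ∷ []
choices-unique {m = suc m} L L! =
  Unique.cartesianProductWith⁺ _∷_ ∷-injective (L! zero) (choices-unique (L ∘ suc) (L! ∘ suc))

^≤length-choices : ∀ {m p} (L : Fin m → List A) → (∀ i → p ≤ length (L i)) → p ^ m ≤ length (choices L)
^≤length-choices {m = zero}  L p≤ = ≤-refl
^≤length-choices {m = suc m} L p≤ = ≤-trans
  (*-mono-≤ (p≤ zero) (^≤length-choices (L ∘ suc) (p≤ ∘ suc)))
  (≤-reflexive (sym (length-cartesianProductWith _∷_ (L zero) (choices (L ∘ suc)))))

2*n≤2^n : ∀ d → 2 * d ≤ 2 ^ d
2*n≤2^n zero          = z≤n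
2*n≤2^n (suc zero)    = ≤-refl
2*n≤2^n (suc (suc d)) = begin
  2 * suc (suc d)               ≡⟨ *-distribˡ-+ 2 1 (suc d) ⟩
  2 + 2 * suc d                 ≤⟨ +-mono-≤ (*-monoʳ-≤ 2 (m^n>0 2 d)) (2*n≤2^n (suc d)) ⟩
  2 ^ suc d + 2 ^ suc d         ≡⟨ cong (2 ^ suc d +_) (+-identityʳ _) ⟨
  2 ^ suc (suc d)               ∎
  where open ≤-Reasoning

-- The product over all lists of the inequalities 2d ≤ 2^d, where d is the length of a list. The
-- factor `2 ^ m` later cancels against the a in the list size q + a.
2^m*length-choices≤ : ∀ {m} (L : Fin m → List A) →
  2 ^ m * length (choices L) ≤ 2 ^ length (concat (tabulate L))
2^m*length-choices≤ {m = zero}  L = ≤-refl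
2^m*length-choices≤ {m = suc m} L = begin
  2 ^ suc m * length (choices L)
    ≡⟨ cong (2 ^ suc m *_) (length-cartesianProductWith _∷_ (L zero) (choices (L ∘ suc))) ⟩
  2 * 2 ^ m * (length (L zero) * length (choices (L ∘ suc)))
    ≡⟨ [m*n]*[o*p]≡[m*o]*[n*p] 2 (2 ^ m) (length (L zero)) _ ⟩
  2 * length (L zero) * (2 ^ m * length (choices (L ∘ suc)))
    ≤⟨ *-mono-≤ (2*n≤2^n (length (L zero))) (2^m*length-choices≤ (L ∘ suc)) ⟩
  2 ^ length (L zero) * 2 ^ length (concat (tabulate (L ∘ suc)))
    ≡⟨ ^-distribˡ-+-* 2 (length (L zero)) _ ⟨
  2 ^ (length (L zero) + length (concat (tabulate (L ∘ suc))))
    ≡⟨ cong (2 ^_) (length-++ (L zero)) ⟨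
  2 ^ length (concat (tabulate L)) ∎
  where open ≤-Reasoning

map-choiceFunctions : ∀ m (L : Fin m → List ℕ) → map Vec.tabulate (choiceFunctions m L) ≡ choices L
map-choiceFunctions zero    L = refl
map-choiceFunctions (suc m) L = go (L zero)
  where
  go : ∀ xs → map Vec.tabulate (concatMap (λ x → map (consF x) (choiceFunctions m (L ∘ suc))) xs)
            ≡ cartesianProductWith _∷_ xs (choices (L ∘ suc))
  go []       = refl
  go (x ∷ xs) = trans (map-++ Vec.tabulate (map (consF x) (choiceFunctions m (L ∘ suc))) _)
    (cong₂ _++_ (trans (sym (map-∘ (choiceFunctions m (L ∘ suc))))
                (trans (map-∘ (choiceFunctions m (L ∘ suc))) (cong (map (x ∷_)) (map-choiceFunctions m (L ∘ suc)))))
                (go xs))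

-- Difference and intersection of color lists.

infixl 6 _∖_ _∩_

_∖_ _∩_ : List ℕ → List ℕ → List ℕ
xs ∖ ys = filter (λ x → ¬? (x ∈? ys)) xs
xs ∩ ys = filter (_∈? ys) xs

∈-∖⁺ : ∀ {x xs ys} → x ∈ xs → x ∉ ys → x ∈ xs ∖ ys
∈-∖⁺ {ys = ys} = ∈-filter⁺ (λ x → ¬? (x ∈? ys))

∈-∖⁻ : ∀ {x} xs ys → x ∈ xs ∖ ys → x ∈ xs × x ∉ ys
∈-∖⁻ xs ys = ∈-filter⁻ (λ x → ¬? (x ∈? ys)) {xs = xs}

∖-unique : ∀ {xs} ys → Unique xs → Unique (xs ∖ ys)
∖-unique ys = Unique.filter⁺ (λ x → ¬? (x ∈? ys))

∩-unique : ∀ {xs} ys → Unique xs → Unique (xs ∩ ys)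
∩-unique ys = Unique.filter⁺ (_∈? ys)

∈-∩⁻ : ∀ {x} xs ys → x ∈ xs ∩ ys → x ∈ xs × x ∈ ys
∈-∩⁻ xs ys = ∈-filter⁻ (_∈? ys) {xs = xs}

length-∩+∖ : ∀ xs ys → length (xs ∩ ys) + length (xs ∖ ys) ≡ length xs
length-∩+∖ xs ys = length-filter-¬ (_∈? ys) xs

-- The removed colors are counted through a cover `zs`, so that a color occurring twice in `ys` need
-- be charged only once.
length-∖≥ : ∀ {xs} ys zs {l} → Unique xs → ys ⊆ zs → l + length zs ≤ length xs → l ≤ length (xs ∖ ys)
length-∖≥ {xs} ys zs {l} xs! ys⊆zs l+∣zs∣≤ = +-cancelʳ-≤ (length zs) l _ (begin
  l + length zs                           ≤⟨ l+∣zs∣≤ ⟩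
  length xs                               ≡⟨ length-∩+∖ xs ys ⟨
  length (xs ∩ ys) + length (xs ∖ ys)     ≤⟨ +-monoˡ-≤ _ (length-unique-⊆ (∩-unique ys xs!) (ys⊆zs ∘ proj₂ ∘ ∈-∩⁻ xs ys)) ⟩
  length zs + length (xs ∖ ys)            ≡⟨ +-comm (length zs) _ ⟩
  length (xs ∖ ys) + length zs            ∎)
  where open ≤-Reasoning

-- If removing `ys` leaves no more than l colors, then the intersection has at least as many
-- elements as `ys` has entries, hence contains all of them.
∖-tight : ∀ {xs} ys {l} → Unique xs → length xs ≡ l + length ys → length (xs ∖ ys) ≤ l → ys ⊆ xs
∖-tight {xs} ys {l} xs! ∣xs∣≡ ∣∖∣≤l =
  proj₁ ∘ ∈-∩⁻ xs ys ∘ unique-⊆-exhausts (∩-unique ys xs!) (proj₂ ∘ ∈-∩⁻ xs ys) ∣ys∣≤∣∩∣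
  where
  open ≤-Reasoning
  ∣ys∣≤∣∩∣ : length ys ≤ length (xs ∩ ys)
  ∣ys∣≤∣∩∣ = +-cancelʳ-≤ l _ _ (begin
    length ys + l                           ≡⟨ +-comm (length ys) l ⟩
    l + length ys                           ≡⟨ ∣xs∣≡ ⟨
    length xs                               ≡⟨ length-∩+∖ xs ys ⟨
    length (xs ∩ ys) + length (xs ∖ ys)     ≤⟨ +-monoʳ-≤ _ ∣∖∣≤l ⟩
    length (xs ∩ ys) + l                    ∎)

-- Colorings of a graph from given lists.

module _ (G : RawGraph) where

  proper? : (c : Fin (n G) → ℕ) → Dec (Proper G c)
  proper? c = Fin.all? λ u → Fin.all? λ v → (adj G u v Bool.≟ true) →-dec ¬? (c u ≟ c v)

  properᵇ-sound : (c : Fin (n G) → ℕ) → T (properᵇ G c) → Proper G c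
  properᵇ-sound c t u v uv c≡ = h (adj G u v) uv
    (All.lookup (All.all⁺ _ _ (All.lookup (All.all⁺ _ _ t) (∈-allFin u))) (∈-allFin v))
    where
    h : ∀ e → e ≡ true → T (not e ∨ not (c u ≡ᵇ c v)) → _
    h true _ s with c u ≡ᵇ c v | ≡⇒≡ᵇ (c u) (c v) c≡
    ... | true | _ = s

  Proper-cong : {c d : Fin (n G) → ℕ} → (∀ v → c v ≡ d v) → Proper G c → Proper G d
  Proper-cong c≡d proper u v uv eq = proper u v uv (trans (c≡d u) (trans eq (sym (c≡d v))))

  colorings : ListAssignment G → List (Vec ℕ (n G))
  colorings L = filter (proper? ∘ lookup) (choices L)

  ∈-colorings⁻ : ∀ L {c} → c ∈ colorings L → IsLColoring G L (lookup c)
  ∈-colorings⁻ L c∈ with c∈ch , pr ← ∈-filter⁻ (proper? ∘ lookup) {xs = choices L} c∈ = pr , ∈-choices⁻ L c∈ch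

  ∈-colorings⁺ : ∀ {L c} → IsLColoring G L c → Vec.tabulate c ∈ colorings L
  ∈-colorings⁺ {L} {c} (pr , c∈L) = ∈-filter⁺ (proper? ∘ lookup)
    (∈-choices⁺ L _ λ i → subst (_∈ L i) (sym (lookup∘tabulate c i)) (c∈L i))
    (Proper-cong (sym ∘ lookup∘tabulate c) pr)

  colorings-unique : ∀ L → (∀ v → Unique (L v)) → Unique (colorings L)
  colorings-unique L L! = Unique.filter⁺ (proper? ∘ lookup) (choices-unique L L!)

  LColorable? : ∀ L → Dec (LColorable G L)
  LColorable? L with colorings L in eq
  ... | []    = no λ (c , col) → contradiction (subst (_ ∈_) eq (∈-colorings⁺ col)) λ ()
  ... | c ∷ _ = yes (lookup c , ∈-colorings⁻ L (subst (c ∈_) (sym eq) (here refl)))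

  numLColorings≤length-colorings : ∀ L → numLColorings G L ≤ length (colorings L)
  numLColorings≤length-colorings L = subst (λ cs → numLColorings G L ≤ length (filter (proper? ∘ lookup) cs))
    (map-choiceFunctions (n G) L)
    (count≤length-filter (properᵇ G) Vec.tabulate (proper? ∘ lookup)
      (λ c t → Proper-cong (sym ∘ lookup∘tabulate c) (properᵇ-sound c t))
      (choiceFunctions (n G) L))

  LColorable-⊆ : ∀ {L L′} → (∀ v → L′ v ⊆ L v) → LColorable G L′ → LColorable G L
  LColorable-⊆ L′⊆L (c , pr , c∈) = c , pr , λ v → L′⊆L v (c∈ v)

  -- Give every vertex the list 0, ..., m-1.
  choosable⇒colorable : ∀ {m} → Choosable G m → Colorable G m
  choosable⇒colorable {m} ch
    with c , pr , c∈ ← ch (λ _ → upTo m) (λ _ → Unique.upTo⁺ m , length-upTo m) =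
    (λ v → fromℕ< (∈-upTo⁻ (c∈ v))) ,
    Proper-cong (λ v → sym (Fin.toℕ-fromℕ< (∈-upTo⁻ (c∈ v)))) pr

-- Lists on a strong chromatic-choosable graph.

-- The k of a strong k-chromatic-choosable graph is written suc q.

module StrongLists (M : Graph) (q : ℕ) (conn : Connected (raw M))
                   (scc : StrongChromaticChoosable (raw M) (suc q)) where

  G : RawGraph
  G = raw M

  V : Set
  V = Fin (n G)

  -- A graph with a 1-coloring has no edges, so connectedness leaves a single vertex.
  q≡0⇒singleton : q ≡ 0 → (u v : V) → u ≡ v
  q≡0⇒singleton refl u v with conn u v
  ... | Reach.here        = refl
  ... | step {v = w} uw _ = contradiction (cong toℕ (Fin1-prop (c u) (c w))) (proj₂ (proj₁ (proj₁ scc)) u w uw)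
    where
    c = proj₁ (proj₁ (proj₁ scc))
    Fin1-prop : (i j : Fin 1) → i ≡ j
    Fin1-prop zero zero = refl

  all-equal-proper : ((u v : V) → u ≡ v) → (c : V → ℕ) → Proper G c
  all-equal-proper eq c u v uv with refl ← eq u v = contradiction (trans (sym uv) (irrefl M u)) λ ()

  -- A single vertex would be 1-colorable, while the chromatic number is at least 2.
  another-vertex : 1 ≤ q → ∀ v → ∃ λ w → w ≢ v
  another-vertex 1≤q v with Fin.any? (λ w → ¬? (w Fin.≟ v))
  ... | yes w≢v = w≢v
  ... | no  all-v = contradiction
    ((λ _ → zero) , all-equal-proper (λ u w → trans (is-v u) (sym (is-v w))) _)
    (proj₂ (proj₁ scc) 1 (s≤s 1≤q))
    where
    is-v : ∀ w → w ≡ v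
    is-v w with w Fin.≟ v
    ... | yes w≡v = w≡v
    ... | no  w≢v = contradiction (w , w≢v) all-v

  module _ (L : ListAssignment G) (L! : ∀ v → Unique (L v)) (q≤ : ∀ v → q ≤ length (L v))
           (¬col : ¬ LColorable G L) where

    -- Shrinking lists preserves uncolorability, so strong choosability applies to any window of q
    -- consecutive colors chosen in each list.
    sublists-constant : (δ : V → ℕ) → (∀ v → q ≤ length (drop (δ v) (L v))) →
      IsConstant G (λ v → take q (drop (δ v) (L v)))
    sublists-constant δ q≤δ = proj₂ scc _
      (λ v → Unique.take⁺ q (Unique.drop⁺ (δ v) (L! v)) ,
             trans (length-take q (drop (δ v) (L v))) (m≤n⇒m⊓n≡m (q≤δ v)))
      (¬col ∘ LColorable-⊆ G λ v → Sublist.lookup (drop-⊆ (δ v) (L v)) ∘ Sublist.lookup (take-⊆ q (drop (δ v) (L v))))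

    -- If L v had more than q elements, then the first q elements of L v and
    -- the q elements following the head would both equal the list at another vertex.
    uncolorable⇒tight : ∀ v → length (L v) ≤ q
    uncolorable⇒tight v with length (L v) ≤? q
    ... | yes ≤q = ≤q
    ... | no  ≰q with q ≟ 0
    -- For q = 0 windows carry no information, but the graph is one vertex and its list is nonempty.
    ...   | yes q≡0 = contradiction
      ((λ _ → x) , all-equal-proper V-prop _ , λ u → subst (λ u → x ∈ L u) (V-prop v u) x∈Lv) ¬col
      where
      V-prop = q≡0⇒singleton q≡0
      nonempty-list : ∀ xs → 0 < length xs → ∃ (_∈ xs)
      nonempty-list (x ∷ xs) _ = x , here refl
      x    = proj₁ (nonempty-list (L v) (≤-<-trans z≤n (≰⇒> ≰q)))
      x∈Lv = proj₂ (nonempty-list (L v) (≤-<-trans z≤n (≰⇒> ≰q)))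
    ...   | no  q≢0 = ⊥-elim (head-case (L v) refl)
      where
      w   = proj₁ (another-vertex (n≢0⇒n>0 q≢0) v)
      w≢v = proj₂ (another-vertex (n≢0⇒n>0 q≢0) v)

      -- The window moves past the head at `v` only. The window at `w` stays put and links the two
      -- windows at `v`, so the head of `L v` would reappear in its tail.
      δ : V → ℕ
      δ u = if does (u Fin.≟ v) then 1 else 0

      δv≡1 : δ v ≡ 1
      δv≡1 with v Fin.≟ v
      ... | yes _  = refl
      ... | no v≢v = contradiction refl v≢v

      δw≡0 : δ w ≡ 0
      δw≡0 with w Fin.≟ v
      ... | yes w≡v = contradiction w≡v w≢v
      ... | no  _   = refl

      q≤δ : ∀ u → q ≤ length (drop (δ u) (L u))
      q≤δ u with u Fin.≟ v
      ... | no  _    = q≤ u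
      ... | yes refl with L v | ≰⇒> ≰q
      ...   | _ ∷ _ | s≤s q≤xs = q≤xs

      head-case : ∀ xs → L v ≡ xs → ⊥
      head-case [] eq = ≰q (subst (λ l → length l ≤ q) (sym eq) z≤n)
      head-case (x ∷ xs) eq = Unique.Unique[x∷xs]⇒x∉xs (subst Unique eq (L! v)) x∈xs
        where
        x∈Lw : x ∈ take q (L w)
        x∈Lw = Equivalence.to (sublists-constant (λ _ → 0) q≤ v w x)
          (subst (λ l → x ∈ take q l) (sym eq) (∈-take-head q≢0))
        x∈δv : x ∈ take q (drop (δ v) (L v))
        x∈δv = Equivalence.to (sublists-constant δ q≤δ w v x)
          (subst (λ d → x ∈ take q (drop d (L w))) (sym δw≡0) x∈Lw)
        x∈xs : x ∈ xs
        x∈xs = Sublist.lookup (take-⊆ q xs) (subst (λ l → x ∈ take q (drop 1 l)) eq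
          (subst (λ d → x ∈ take q (drop d (L v))) δv≡1 x∈δv))

    uncolorable⇒constant : IsConstant G L
    uncolorable⇒constant = proj₂ scc L (λ v → L! v , ≤-antisym (uncolorable⇒tight v) (q≤ v)) ¬col

  -- The contrapositive of tightness: one list with a spare color suffices. Decidability of
  -- `LColorable` turns the refutation into a coloring.
  colorable-if-long : (L : ListAssignment G) → (∀ v → Unique (L v)) → (∀ v → q ≤ length (L v)) →
    ∀ v → q < length (L v) → LColorable G L
  colorable-if-long L L! q≤ v q< with LColorable? G L
  ... | yes col = col
  ... | no ¬col = contradiction (uncolorable⇒tight L L! q≤ ¬col v) (<⇒≱ q<)

  -- Delete `x` from all lists. More than q colors remain everywhere, so there is a coloring
  -- avoiding `x`, and recoloring `v` with `x` keeps it proper.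
  extend-color : (L : ListAssignment G) → (∀ v → Unique (L v)) → (∀ v → suc q < length (L v)) →
    ∀ v {x} → x ∈ L v → ∃ λ c → IsLColoring G L c × c v ≡ x
  extend-color L L! long v {x} x∈Lv = c , (proper-c , c∈L) , c-v
    where
    L∖x : ListAssignment G
    L∖x u = L u ∖ [ x ]
    long∖ : ∀ u → q < length (L∖x u)
    long∖ u = length-∖≥ [ x ] [ x ] (L! u) id (subst (_≤ length (L u)) (sym (+-comm (suc q) 1)) (long u))
    d-col : LColorable G L∖x
    d-col = colorable-if-long L∖x (∖-unique [ x ] ∘ L!) (<⇒≤ ∘ long∖) v (long∖ v)
    d = proj₁ d-col
    d≢x : ∀ u → d u ≢ x
    d≢x u du≡x = proj₂ (∈-∖⁻ (L u) [ x ] (proj₂ (proj₂ d-col) u)) (here du≡x)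
    c : V → ℕ
    c u = if does (u Fin.≟ v) then x else d u
    c-v : c v ≡ x
    c-v with v Fin.≟ v
    ... | yes _  = refl
    ... | no v≢v = contradiction refl v≢v
    c∈L : ∀ u → c u ∈ L u
    c∈L u with u Fin.≟ v
    ... | yes refl = x∈Lv
    ... | no  _    = proj₁ (∈-∖⁻ (L u) [ x ] (proj₂ (proj₂ d-col) u))
    proper-c : Proper G c
    proper-c u w uw with u Fin.≟ v | w Fin.≟ v
    ... | yes refl | yes refl = contradiction (trans (sym uw) (irrefl M v)) λ ()
    ... | yes _    | no  _    = d≢x w ∘ sym
    ... | no  _    | yes _    = d≢x u
    ... | no  _    | no  _    = proj₁ (proj₂ d-col) u w uw

  -- Extending colorings from one part of the product to the other.

  module Extension {a b : ℕ} (A : Fin a → ListAssignment G) (B : Fin b → ListAssignment G)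
           (A-assignment : ∀ i → IsKAssignment G (q + a) (A i))
           (B-assignment : ∀ j → IsKAssignment G (q + a) (B j)) where

    used : (Fin a → V → ℕ) → V → List ℕ
    used c v = tabulate (λ i → c i v)

    residual : (Fin a → V → ℕ) → ListAssignment G → ListAssignment G
    residual c L v = L v ∖ used c v

    Extendable : (Fin a → V → ℕ) → Set
    Extendable c = (∀ i → IsLColoring G (A i) (c i)) × (∀ j → LColorable G (residual c (B j)))

    residual-unique : ∀ c j v → Unique (residual c (B j) v)
    residual-unique c j v = ∖-unique (used c v) (proj₁ (B-assignment j v))

    ∣B∣≡q+∣used∣ : ∀ c j v → length (B j v) ≡ q + length (used c v)
    ∣B∣≡q+∣used∣ c j v = trans (proj₂ (B-assignment j v)) (cong (q +_) (sym (length-tabulate (λ i → c i v))))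

    q≤∣residual∣ : ∀ c j v → q ≤ length (residual c (B j) v)
    q≤∣residual∣ c j v = length-∖≥ (used c v) (used c v) (proj₁ (B-assignment j v)) id
      (≤-reflexive (sym (∣B∣≡q+∣used∣ c j v)))

    -- Giving two copies the same color at v leaves every copy in the other part an extra color at v.
    extendable-overlap : ∀ v {i j x} → i ≢ j → x ∈ A i v → x ∈ A j v → ∃ Extendable
    extendable-overlap v {i} {j} {x} i≢j x∈Ai x∈Aj = c , (λ l → proj₁ (proj₂ (pick l))) , λ l →
      colorable-if-long (residual c (B l)) (residual-unique c l) (q≤∣residual∣ c l) v (long l)
      where
      -- Two distinct copies force a ≥ 2, so the lists have the q + 2 colors that `extend-color`
      -- asks for.
      2≤a = 2≤-distinct i j i≢j
      A-long : ∀ l u → suc q < length (A l u)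
      A-long l u = subst₂ _≤_ (+-comm q 2) (sym (proj₂ (A-assignment l u))) (+-monoʳ-≤ q 2≤a)
      pick : ∀ l → ∃ λ c → IsLColoring G (A l) c × (x ∈ A l v → c v ≡ x)
      pick l with x ∈? A l v
      ... | yes x∈ with d , col , dv ← extend-color (A l) (proj₁ ∘ A-assignment l) (A-long l) v x∈ =
        d , col , λ _ → dv
      ... | no  x∉ with d , col ← colorable-if-long (A l) (proj₁ ∘ A-assignment l)
                                    (λ u → ≤-trans (n≤1+n q) (<⇒≤ (A-long l u))) v (<⇒≤ (A-long l v)) =
        d , col , λ x∈ → contradiction x∈ x∉
      c : Fin a → V → ℕ
      c l = proj₁ (pick l)
      long : ∀ l → q < length (residual c (B l) v)
      -- Copies `i` and `j` share `x` at `v`, so the a used colors there are covered by a - 1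
      -- values.
      long l with ys , used⊆ys , ∣ys∣ ← repeated-value (λ l → c l v) i≢j
                    (trans (proj₂ (proj₂ (pick i)) x∈Ai) (sym (proj₂ (proj₂ (pick j)) x∈Aj))) =
        length-∖≥ (used c v) ys (proj₁ (B-assignment l v)) used⊆ys (≤-reflexive
          (trans (sym (+-suc q (length ys))) (trans (cong (q +_) ∣ys∣) (sym (proj₂ (B-assignment l v))))))

    module _ (disjoint : ∀ v {i j x} → x ∈ A i v → x ∈ A j v → i ≡ j) where

      v₀ : V
      v₀ = fromℕ< (nonempty M)

      -- The residual lists of a bad coloring c all equal B j v₀ minus the colors used at v₀;
      -- hence the colors used at v are known, and disjointness tells which copy uses which.
      bad-determined : ∀ j {c d : Fin a → V → ℕ} →
        (∀ i v → c i v ∈ A i v) → (∀ i v → d i v ∈ A i v) →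
        ¬ LColorable G (residual c (B j)) → ¬ LColorable G (residual d (B j)) →
        (∀ i → c i v₀ ≡ d i v₀) → ∀ i v → c i v ≡ d i v
      bad-determined j {c} {d} c∈A d∈A bad-c bad-d eq₀ i v with c i v ∈? used d v
      ... | yes ci∈d with l , ci≡dl ← ∈-tabulate⁻ {f = λ i → d i v} ci∈d
                     with refl ← disjoint v (c∈A i v) (subst (_∈ A l v) (sym ci≡dl) (d∈A l v)) = ci≡dl
      -- Here `c i v` would be left over by `d` at `v`, hence at `v₀`. There `c` and `d` use the
      -- same colors, so `c` leaves it over too, and by constancy also at `v`, where `c` uses it.
      ... | no  ci∉d = contradiction (∈-tabulate⁺ {f = λ i → c i v} i) ci∉c
        where
        constant : ∀ c → ¬ LColorable G (residual c (B j)) → IsConstant G (residual c (B j))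
        constant c = uncolorable⇒constant (residual c (B j)) (residual-unique c j) (q≤∣residual∣ c j)
        ci∈B : c i v ∈ B j v
        ci∈B = ∖-tight (used c v) (proj₁ (B-assignment j v)) (∣B∣≡q+∣used∣ c j v)
          (uncolorable⇒tight (residual c (B j)) (residual-unique c j) (q≤∣residual∣ c j) bad-c v)
          (∈-tabulate⁺ {f = λ i → c i v} i)
        in-d₀ : c i v ∈ residual d (B j) v₀
        in-d₀ = Equivalence.to (constant d bad-d v v₀ (c i v)) (∈-∖⁺ ci∈B ci∉d)
        in-c₀ : c i v ∈ residual c (B j) v₀
        in-c₀ = subst (λ ys → c i v ∈ B j v₀ ∖ ys) (sym (tabulate-cong eq₀)) in-d₀
        ci∉c : c i v ∉ used c v
        ci∉c = proj₂ (∈-∖⁻ (B j v) (used c v) (Equivalence.to (constant c bad-c v₀ v (c i v)) in-c₀))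

      col : Vec (Vec ℕ (n G)) a → Fin a → V → ℕ
      col c i = lookup (lookup c i)

      Coloring : Vec (Vec ℕ (n G)) a → Set
      Coloring c = ∀ i → IsLColoring G (A i) (col c i)

      Bad : Fin b → Vec (Vec ℕ (n G)) a → Set
      Bad j c = ¬ LColorable G (residual (col c) (B j))

      trace : Vec (Vec ℕ (n G)) a → Vec ℕ a
      trace c = Vec.tabulate (λ i → col c i v₀)

      trace-injective : ∀ j {c d} → Coloring c × Bad j c → Coloring d × Bad j d → trace c ≡ trace d → c ≡ d
      trace-injective j {c} {d} (col-c , bad-c) (col-d , bad-d) eq = lookup-ext λ i → lookup-ext λ v →
        bad-determined j (proj₂ ∘ col-c) (proj₂ ∘ col-d) bad-c bad-d
          (λ i → trans (sym (lookup∘tabulate _ i)) (trans (cong (λ t → lookup t i) eq) (lookup∘tabulate _ i))) i v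

      common : Fin b → Fin a → List ℕ
      common j i = A i v₀ ∩ B j v₀

      -- The lists `common j i` are disjoint parts of `B j v₀`, so their lengths sum to at most q +
      -- a. Cancelling `2 ^ a` leaves `2 ^ q`.
      length-choices-common : ∀ j → length (choices (common j)) ≤ 2 ^ q
      length-choices-common j = *-cancelˡ-≤ (2 ^ a) {{m^n≢0 2 a}} (begin
        2 ^ a * length (choices (common j))        ≤⟨ 2^m*length-choices≤ (common j) ⟩
        2 ^ length (concat (tabulate (common j)))  ≤⟨ ^-monoʳ-≤ 2 (length-unique-⊆ common! common⊆B) ⟩
        2 ^ length (B j v₀)                        ≡⟨ cong (2 ^_) (trans (proj₂ (B-assignment j v₀)) (+-comm q a)) ⟩
        2 ^ (a + q)                                ≡⟨ ^-distribˡ-+-* 2 a q ⟩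
        2 ^ a * 2 ^ q                              ∎)
        where
        open ≤-Reasoning
        common! : Unique (concat (tabulate (common j)))
        common! = Unique.concat⁺ (All.tabulate⁺ λ i → ∩-unique (B j v₀) (proj₁ (A-assignment i v₀)))
          (AllPairs.tabulate⁺ λ {i} {l} i≢l (x∈i , x∈l) → i≢l (disjoint v₀
            (proj₁ (∈-∩⁻ (A i v₀) (B j v₀) x∈i)) (proj₁ (∈-∩⁻ (A l v₀) (B j v₀) x∈l))))
        common⊆B : concat (tabulate (common j)) ⊆ B j v₀
        common⊆B x∈ with xs , x∈xs , xs∈ ← ∈-concat⁻′ (tabulate (common j)) x∈
                    with i , refl ← ∈-tabulate⁻ {f = common j} xs∈ = proj₂ (∈-∩⁻ (A i v₀) (B j v₀) x∈xs)

      -- Tightness at `v₀` puts every color used there into `B j v₀`, so each trace is a choice from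
      -- the lists `common j`, and a bad coloring is recovered from its trace.
      length-bad : ∀ j cs → Unique cs → All Coloring cs → All (Bad j) cs → length cs ≤ 2 ^ q
      length-bad j cs cs! colored bad = begin
        length cs                     ≡⟨ length-map trace cs ⟨
        length (map trace cs)         ≤⟨ length-unique-⊆ (unique-map trace (trace-injective j) (All.zip (colored , bad)) cs!) traces⊆ ⟩
        length (choices (common j))   ≤⟨ length-choices-common j ⟩
        2 ^ q                         ∎
        where
        open ≤-Reasoning
        traces⊆ : map trace cs ⊆ choices (common j)
        traces⊆ t∈ with c , c∈ , refl ← ∈-map⁻ trace t∈ =
          ∈-choices⁺ (common j) (trace c) λ i → subst (_∈ common j i) (sym (lookup∘tabulate _ i))
            (∈-filter⁺ (_∈? B j v₀) (proj₂ (All.lookup colored c∈ i) v₀)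
              (∖-tight (used (col c) v₀) (proj₁ (B-assignment j v₀)) (∣B∣≡q+∣used∣ (col c) j v₀)
                (uncolorable⇒tight (residual (col c) (B j)) (residual-unique (col c) j)
                  (q≤∣residual∣ (col c) j) (All.lookup bad c∈) v₀)
                (∈-tabulate⁺ {f = λ i → col c i v₀} i)))

      extendable-disjoint : ∀ {p} → (∀ i → p ≤ numLColorings G (A i)) → 2 ^ q * b < p ^ a → ∃ Extendable
      extendable-disjoint {p} p≤ lt
        -- At least p^a families of colorings exist, and each of the b copies rules out at most
        -- `2 ^ q` of them.
        with c , c∈ , good ← avoid b Bad (λ j c → ¬? (LColorable? G (residual (col c) (B j)))) length-bad
               (choices λ i → colorings G (A i))
               (choices-unique _ λ i → colorings-unique G (A i) (proj₁ ∘ A-assignment i))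
               (All.tabulate λ c∈ i → ∈-colorings⁻ G (A i) (∈-choices⁻ _ c∈ i))
               (<-≤-trans (subst (_< p ^ a) (*-comm (2 ^ q) b) lt)
                 (^≤length-choices _ λ i → ≤-trans (p≤ i) (numLColorings≤length-colorings G (A i)))) =
        col c , (λ i → ∈-colorings⁻ G (A i) (∈-choices⁻ _ c∈ i)) , λ j → decidable-stable (LColorable? G _) (good j)

    extendable : ∀ {p} → (∀ i → p ≤ numLColorings G (A i)) → 2 ^ q * b < p ^ a → ∃ Extendable
    extendable p≤ lt
      with Fin.any? (λ v → Fin.any? λ i → Fin.any? λ j → ¬? (i Fin.≟ j) ×-dec Any.any? (_∈? A j v) (A i v))
    ... | yes (v , i , j , i≢j , Ai∩Aj) with x , x∈Ai , x∈Aj ← find Ai∩Aj = extendable-overlap v i≢j x∈Ai x∈Aj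
    ... | no  none = extendable-disjoint disjoint p≤ lt
      where
      disjoint : ∀ v {i j x} → x ∈ A i v → x ∈ A j v → i ≡ j
      disjoint v {i} {j} x∈Ai x∈Aj with i Fin.≟ j
      ... | yes i≡j = i≡j
      ... | no  i≢j = contradiction (v , i , j , i≢j , lose x∈Ai x∈Aj) none

-- Colorings of the product with `K a b`.

splitAt-inj₁⇒<ᵇ : ∀ a {b} (x : Fin (a + b)) {i} → splitAt a x ≡ inj₁ i → (toℕ x <ᵇ a) ≡ true
splitAt-inj₁⇒<ᵇ a x {i} eq with refl ← Fin.splitAt⁻¹-↑ˡ {a} {i = x} eq =
  Equivalence.to T-≡ (<⇒<ᵇ (subst (_< a) (sym (Fin.toℕ-↑ˡ i _)) (Fin.toℕ<n i)))

splitAt-inj₂⇒≮ᵇ : ∀ a {b} (x : Fin (a + b)) {j} → splitAt a x ≡ inj₂ j → (toℕ x <ᵇ a) ≡ false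
splitAt-inj₂⇒≮ᵇ a x {j} eq with refl ← Fin.splitAt⁻¹-↑ʳ {a} {i = x} eq = ¬-not λ x<ᵇa →
  <⇒≱ (<ᵇ⇒< _ a (Equivalence.from T-≡ x<ᵇa)) (subst (a ≤_) (sym (Fin.toℕ-↑ʳ a j)) (m≤m+n a (toℕ j)))

module _ (G : RawGraph) {a b : ℕ} (L : ListAssignment (G □ K a b)) where

  leftLists : Fin a → ListAssignment G
  leftLists i v = L (combine v (i ↑ˡ b))

  rightLists : Fin b → ListAssignment G
  rightLists j v = L (combine v (a ↑ʳ j))

  -- A product edge either lies inside one copy of `G`, where that copy's coloring is proper, or
  -- joins a left and a right copy at the same vertex, where `c` and `d` differ.
  □K-colorable : (c : Fin a → Fin (n G) → ℕ) (d : Fin b → Fin (n G) → ℕ) →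
    (∀ i → IsLColoring G (leftLists i) (c i)) → (∀ j → IsLColoring G (rightLists j) (d j)) →
    (∀ i j v → c i v ≢ d j v) → LColorable (G □ K a b) L
  □K-colorable c d c-col d-col c≢d =
    (λ z → color (proj₁ (remQuot {n G} (a + b) z)) (proj₂ (remQuot {n G} (a + b) z))) ,
    (λ z z′ → color-proper _ _ _ _) ,
    (λ z → subst (λ y → color (proj₁ (remQuot {n G} (a + b) z)) (proj₂ (remQuot {n G} (a + b) z)) ∈ L y)
             (Fin.combine-remQuot {n G} (a + b) z) (color∈L _ _))
    where
    color : Fin (n G) → Fin (a + b) → ℕ
    color u x = [ (λ i → c i u) , (λ j → d j u) ]′ (splitAt a x)

    color∈L : ∀ u x → color u x ∈ L (combine u x)
    color∈L u x with splitAt a x in eq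
    ... | inj₁ i = subst (λ x → c i u ∈ L (combine u x)) (Fin.splitAt⁻¹-↑ˡ eq) (proj₂ (c-col i) u)
    ... | inj₂ j = subst (λ x → d j u ∈ L (combine u x)) (Fin.splitAt⁻¹-↑ʳ eq) (proj₂ (d-col j) u)

    K-edge : ∀ u x x′ → adj (K a b) x x′ ≡ true → color u x ≢ color u x′
    K-edge u x x′ xx′ with splitAt a x in eq | splitAt a x′ in eq′
    ... | inj₁ i | inj₂ j = c≢d i j u
    ... | inj₂ j | inj₁ i = c≢d i j u ∘ sym
    -- Within one part the `xor` in `K` is false, so there is no such edge.
    ... | inj₁ _ | inj₁ _
      rewrite splitAt-inj₁⇒<ᵇ a x eq | splitAt-inj₁⇒<ᵇ a x′ eq′ = contradiction xx′ λ ()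
    ... | inj₂ _ | inj₂ _
      rewrite splitAt-inj₂⇒≮ᵇ a x eq | splitAt-inj₂⇒≮ᵇ a x′ eq′ = contradiction xx′ λ ()

    G-edge : ∀ u u′ x → adj G u u′ ≡ true → color u x ≢ color u′ x
    G-edge u u′ x uu′ with splitAt a x
    ... | inj₁ i = proj₁ (c-col i) u u′ uu′
    ... | inj₂ j = proj₁ (d-col j) u u′ uu′

    color-proper : ∀ u x u′ x′ → (u ≡F u′ ∧ adj (K a b) x x′) ∨ (x ≡F x′ ∧ adj G u u′) ≡ true →
      color u x ≢ color u′ x′
    color-proper u x u′ x′ e with Equivalence.to T-∨ (Equivalence.from T-≡ e)
    ... | inj₁ t with u≡u′ , xx′ ← Equivalence.to T-∧ t
                 with refl ← toWitness {a? = u Fin.≟ u′} u≡u′ = K-edge u x x′ (Equivalence.to T-≡ xx′)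
    ... | inj₂ t with x≡x′ , uu′ ← Equivalence.to T-∧ t
                 with refl ← toWitness {a? = x Fin.≟ x′} x≡x′ = G-edge u u′ x (Equivalence.to T-≡ uu′)

-- Color the left copies by an extendable family and the right copies from the residual lists, which
-- omit every left color at the same vertex.
□K-choosable : ∀ {a b p q} (M : Graph) → Connected (raw M) → StrongChromaticChoosable (raw M) (suc q) →
  (∀ L → IsKAssignment (raw M) (q + a) L → p ≤ numLColorings (raw M) L) →
  2 ^ q * b < p ^ a → Choosable (raw M □ K a b) (q + a)
□K-choosable {a} {b} {q = q} M conn scc p≤ lt L L-assignment =
  □K-colorable G L c (λ j → proj₁ (d-col j)) c-col
    (λ j → proj₁ (proj₂ (d-col j)) , λ v → proj₁ (d∈residual j v))
    (λ i j v c≡d → proj₂ (d∈residual j v) (subst (_∈ used c v) c≡d (∈-tabulate⁺ {f = λ i → c i v} i)))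
  where
  open StrongLists M q conn scc
  left : Fin a → ListAssignment G
  left = leftLists G L
  right : Fin b → ListAssignment G
  right = rightLists G {a} L
  left-assignment : ∀ i → IsKAssignment G (q + a) (left i)
  left-assignment i v = L-assignment _
  right-assignment : ∀ j → IsKAssignment G (q + a) (right j)
  right-assignment j v = L-assignment _
  open Extension left right left-assignment right-assignment
  extension = extendable (λ i → p≤ _ (left-assignment i)) lt
  c     = proj₁ extension
  c-col = proj₁ (proj₂ extension)
  d-col = proj₂ (proj₂ extension)
  d∈residual : ∀ j v → proj₁ (d-col j) v ∈ right j v × proj₁ (d-col j) v ∉ used c v
  d∈residual j v = ∈-∖⁻ (right j v) (used c v) (proj₂ (proj₂ (d-col j)) v)

theorem1p12 : (a k : ℕ) → 1 ≤ a → 1 ≤ k → (M : Graph) →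
    Connected (raw M) → StrongChromaticChoosable (raw M) k →
    (p b : ℕ) → ListColorFunction (raw M) (k + a ∸ 1) p → IsFa a (raw M) b →
    p ^ a ≤ 2 ^ (k ∸ 1) * b
theorem1p12 a (suc q) _ _ M conn scc p b (_ , p≤) (_ , (c , M-choice , □K-choice) , _) =
  -- As χ ≤ χ_ℓ gives q + 1 ≤ c, the number q + a is below c + a, the least size for which the
  -- product is choosable.
  ≮⇒≥ λ lt → proj₂ □K-choice (q + a) (+-monoˡ-≤ a k≤c) (□K-choosable M conn scc p≤ lt)
  where
  k≤c : suc q ≤ c
  k≤c = ≮⇒≥ λ c<k → proj₂ (proj₁ scc) c c<k (choosable⇒colorable (raw M) (proj₁ M-choice))
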